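{- Let $G$ be a graph and $u\in V(G)$. Let $H$ be the graph obtained from $G$ by attaching a false twin $u'$ to $u$, i.e. by adding a new vertex $u'$ whose neighbors are exactly the vertices of $N_G(u)$. Then $\gamma_I(H)=\gamma_I(G)$ or $\gamma_I(H)=\gamma_I(G)+1$.
   Context: All graphs are finite, simple and undirected. $N(v)$ denotes the open neighborhood of a vertex $v$. An Italian dominating function (IDF) of a graph $G$ is a function $f:V(G)\to\{0,1,2\}$ such that every $v\in V(G)$ with $f(v)=0$ satisfies $\sum_{u\in N(v)}f(u)\ge 2$. Its weight is $\sum_{v\in V(G)}f(v)$, and the Italian domination number $\gamma_I(G)$ is the minimum weight of an IDF of $G$. -}

module Defs where

open import Data.Empty using (⊥)
open import Data.Fin using (Fin; zero; suc; toℕ; finToFun; funToFin)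
open import Data.Fin.Patterns using (0F; 2F)
open import Data.Fin.Properties using (all?; finToFun-funToFin) renaming (_≟_ to _≟ᶠ_)
open import Data.List using (List; map; filter; allFin; sum)
open import Data.List.Extrema.Nat using (argmin; argmin-all; f[argmin]≤v⁺)
open import Data.List.Membership.Propositional using (lose)
open import Data.List.Membership.Propositional.Properties using (∈-map⁺; ∈-filter⁺; ∈-allFin)
open import Data.List.Properties using (map-cong)
open import Data.List.Relation.Unary.All.Properties using (all-filter)
open import Data.Nat using (ℕ; suc; _^_; _≤_; _≤?_)
open import Data.Nat.Properties using (≤-reflexive)
open import Data.Product using (∃; _×_; _,_)
open import Data.Sum using (inj₂)
open import Function using (_∘_; const)
open import Relation.Binary using (Decidable; Symmetric; Irreflexive)
open import Relation.Binary.PropositionalEquality using (_≡_; _≗_; refl; sym; trans; cong; subst)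
open import Relation.Nullary using (Dec; no; _→-dec_)

record Graph (n : ℕ) : Set₁ where
  field
    Adj    : Fin n → Fin n → Set
    adj?   : Decidable Adj
    symm   : Symmetric Adj
    irrefl : Irreflexive _≡_ Adj

  N : Fin n → List (Fin n)
  N v = filter (adj? v) (allFin n)

open Graph public using (N)

Labelling : ℕ → Set
Labelling n = Fin n → Fin 3

sumOver : ∀ {n} → Labelling n → List (Fin n) → ℕ
sumOver f vs = sum (map (toℕ ∘ f) vs)

weight : ∀ {n} → Labelling n → ℕ
weight {n} f = sumOver f (allFin n)

IsIDF : ∀ {n} → Graph n → Labelling n → Set
IsIDF G f = ∀ v → f v ≡ 0F → 2 ≤ sumOver f (N G v)

isIDF? : ∀ {n} (G : Graph n) (f : Labelling n) → Dec (IsIDF G f)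
isIDF? G f = all? λ v → (f v ≟ᶠ 0F) →-dec (2 ≤? sumOver f (N G v))

allLabellings : ∀ n → List (Labelling n)
allLabellings n = map finToFun (allFin (3 ^ n))

-- The starting value const 2F of argmin is itself an IDF, so it does not
-- affect the minimum; see γI-attained and γI-minimal.
γI : ∀ {n} → Graph n → ℕ
γI {n} G = weight (argmin weight (const 2F) (filter (isIDF? G) (allLabellings n)))

γI-attained : ∀ {n} (G : Graph n) → ∃ λ f → IsIDF G f × weight f ≡ γI G
γI-attained {n} G =
  _ , argmin-all weight (λ _ ()) (all-filter (isIDF? G) (allLabellings n)) , refl

sumOver-cong : ∀ {n} {f g : Labelling n} → f ≗ g → ∀ vs → sumOver f vs ≡ sumOver g vs
sumOver-cong f≗g vs = cong sum (map-cong (cong toℕ ∘ f≗g) vs)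

IsIDF-resp-≗ : ∀ {n} (G : Graph n) {f g : Labelling n} → f ≗ g → IsIDF G f → IsIDF G g
IsIDF-resp-≗ G f≗g idf v gv≡0 =
  subst (2 ≤_) (sumOver-cong f≗g (N G v)) (idf v (trans (f≗g v) gv≡0))

γI-minimal : ∀ {n} (G : Graph n) (f : Labelling n) → IsIDF G f → γI G ≤ weight f
γI-minimal {n} G f idf = f[argmin]≤v⁺ {f = weight} (const 2F) (filter (isIDF? G) (allLabellings n))
  (inj₂ (lose
    (∈-filter⁺ (isIDF? G) (∈-map⁺ finToFun (∈-allFin (funToFin f)))
      (IsIDF-resp-≗ G (sym ∘ finToFun-funToFin f) idf))
    (≤-reflexive (sumOver-cong (finToFun-funToFin f) (allFin n)))))

module _ {n : ℕ} (G : Graph n) (u : Fin n) where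
  open Graph G

  -- The new vertex u' is zero; an old vertex v becomes suc v.
  TwinAdj : Fin (suc n) → Fin (suc n) → Set
  TwinAdj zero    zero    = ⊥
  TwinAdj zero    (suc w) = Adj u w
  TwinAdj (suc v) zero    = Adj v u
  TwinAdj (suc v) (suc w) = Adj v w

  attachFalseTwin : Graph (suc n)
  attachFalseTwin = record
    { Adj    = TwinAdj
    ; adj?   = twinAdj?
    ; symm   = λ {x} {y} → twinSymm x y
    ; irrefl = λ {x} → λ { refl → twinIrrefl x }
    }
    where
    twinAdj? : Decidable TwinAdj
    twinAdj? zero    zero    = no λ ()
    twinAdj? zero    (suc w) = adj? u w
    twinAdj? (suc v) zero    = adj? v u
    twinAdj? (suc v) (suc w) = adj? v w

    twinSymm : ∀ x y → TwinAdj x y → TwinAdj y x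
    twinSymm zero    (suc w) = symm
    twinSymm (suc v) zero    = symm
    twinSymm (suc v) (suc w) = symm

    twinIrrefl : ∀ x → TwinAdj x x → ⊥
    twinIrrefl (suc v) = irrefl refl

{-# OPTIONS --safe #-}
-- Upper bound: giving the twin u' the label 1 extends any IDF of G, since u' then needs nothing
-- from its neighbours.  Lower bound: in an IDF of the twin graph, move the label of u' onto u,
-- truncating the sum at 2.  A neighbour of u sees the same total as before unless the truncation
-- is effective, and then u alone already gives it 2; other vertices never counted u'.
module Submission where

open import Defs
open import Data.Fin as Fin using (Fin; zero; suc; toℕ; fromℕ<)
open import Data.Fin.Patterns using (0F; 1F)
open import Data.Fin.Properties as Fin using (toℕ-fromℕ<; toℕ≤pred[n]; toℕ-injective)
open import Data.List using (List; []; _∷_; map; filter; allFin; tabulate)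
open import Data.List.Membership.Propositional using (_∈_)
open import Data.List.Membership.Propositional.Properties using (∈-filter⁺; ∈-allFin)
open import Data.List.Properties using (map-∘; map-tabulate; filter-accept; filter-reject)
open import Data.List.Relation.Unary.Any using (here; there)
open import Data.Nat using (ℕ; suc; _+_; _⊓_; _≤_; z≤n; s≤s)
open import Data.Nat.ListAction using (sum)
open import Data.Nat.Properties
  using (≤-refl; ≤-reflexive; ≤-trans; ≤-antisym; n≤0⇒n≡0; m≤n⇒m<n∨m≡n; m≤n+m; +-comm; +-mono-≤;
         +-monoˡ-≤; +-cancelˡ-≤; +-distribˡ-⊓; +-commutativeSemigroup; m⊓n≤m; m⊓n≤n; ⊓-glb; ⊓-monoˡ-≤;
         module ≤-Reasoning)
open import Algebra.Properties.CommutativeSemigroup +-commutativeSemigroup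
  using (x∙yz≈y∙xz; x∙yz≈z∙xy; xy∙z≈y∙xz)
open import Data.Product using (_,_)
open import Data.Sum using (_⊎_; inj₁; inj₂)
open import Data.Vec.Functional using (Vector; updateAt) renaming (_∷_ to _∷ᵛ_)
open import Data.Vec.Functional.Properties using (updateAt-updates)
open import Data.Vec.Functional.Relation.Binary.Pointwise using (Pointwise)
open import Function using (_∘_; id; case_of_)
open import Level using (Level)
open import Relation.Binary using (Rel; Reflexive)
open import Relation.Binary.PropositionalEquality
  using (_≡_; _≢_; refl; sym; trans; cong; subst; module ≡-Reasoning)
open import Relation.Nullary using (¬_; yes; no; contradiction)
open import Relation.Unary using (Pred; Decidable)

private
  variable
    a b ℓ : Level
    A : Set a
    B : Set b
    c m n : ℕ

filter-map : {P : Pred B ℓ} (P? : Decidable P) (f : A → B) (xs : List A) →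
             filter P? (map f xs) ≡ map f (filter (P? ∘ f) xs)
filter-map P? f []       = refl
filter-map P? f (x ∷ xs) with P? (f x)
... | yes _ = cong (f x ∷_) (filter-map P? f xs)
... | no  _ = filter-map P? f xs

filter-tabulate : {P : Pred A ℓ} (P? : Decidable P) (f : Fin n → A) →
                  filter P? (tabulate f) ≡ map f (filter (P? ∘ f) (allFin n))
filter-tabulate {n = n} P? f = begin
  filter P? (tabulate f)              ≡⟨ cong (filter P?) (map-tabulate id f) ⟨
  filter P? (map f (allFin n))        ≡⟨ filter-map P? f (allFin n) ⟩
  map f (filter (P? ∘ f) (allFin n))  ∎
  where open ≡-Reasoning

m⊓[n+o]≤n+[m⊓o] : ∀ m n o → m ⊓ (n + o) ≤ n + m ⊓ o
m⊓[n+o]≤n+[m⊓o] m n o = begin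
  m ⊓ (n + o)        ≤⟨ ⊓-monoˡ-≤ (n + o) (m≤n+m m n) ⟩
  (n + m) ⊓ (n + o)  ≡⟨ +-distribˡ-⊓ n m o ⟨
  n + m ⊓ o          ∎
  where open ≤-Reasoning

module _ {f g : A → ℕ} (f≤g : ∀ x → f x ≤ g x) where

  sum-map-mono-≤ : ∀ xs → sum (map f xs) ≤ sum (map g xs)
  sum-map-mono-≤ []       = z≤n
  sum-map-mono-≤ (x ∷ xs) = +-mono-≤ (f≤g x) (sum-map-mono-≤ xs)

  ⊓-sum-map-absorb-≤ : ∀ k {x xs} → c ⊓ (k + f x) ≤ g x → x ∈ xs →
                       c ⊓ (k + sum (map f xs)) ≤ sum (map g xs)
  ⊓-sum-map-absorb-≤ {c} k {x} {_ ∷ xs} x-absorbs (here refl) = begin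
    c ⊓ (k + (f x + sum (map f xs)))  ≡⟨ cong (c ⊓_) (x∙yz≈z∙xy k (f x) _) ⟩
    c ⊓ (sum (map f xs) + (k + f x))  ≤⟨ m⊓[n+o]≤n+[m⊓o] c _ (k + f x) ⟩
    sum (map f xs) + c ⊓ (k + f x)    ≤⟨ +-mono-≤ (sum-map-mono-≤ xs) x-absorbs ⟩
    sum (map g xs) + g x              ≡⟨ +-comm (sum (map g xs)) (g x) ⟩
    g x + sum (map g xs)              ∎
    where open ≤-Reasoning
  ⊓-sum-map-absorb-≤ {c} k {xs = y ∷ xs} x-absorbs (there x∈xs) = begin
    c ⊓ (k + (f y + sum (map f xs)))  ≡⟨ cong (c ⊓_) (x∙yz≈y∙xz k (f y) _) ⟩
    c ⊓ (f y + (k + sum (map f xs)))  ≤⟨ m⊓[n+o]≤n+[m⊓o] c (f y) _ ⟩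
    f y + c ⊓ (k + sum (map f xs))    ≤⟨ +-mono-≤ (f≤g y) (⊓-sum-map-absorb-≤ k x-absorbs x∈xs) ⟩
    g y + sum (map g xs)              ∎
    where open ≤-Reasoning

module _ {R : Rel A ℓ} (R-refl : Reflexive R) {f : A → A} where

  Pointwise-updateAt : (i : Fin n) (xs : Vector A n) → R (xs i) (f (xs i)) →
                       Pointwise R xs (updateAt xs i f)
  Pointwise-updateAt zero    xs r zero    = r
  Pointwise-updateAt zero    xs r (suc j) = R-refl
  Pointwise-updateAt (suc i) xs r zero    = R-refl
  Pointwise-updateAt (suc i) xs r (suc j) = Pointwise-updateAt i (xs ∘ suc) r j

infixl 6 _⊕_

_⊕_ : Fin (suc c) → Fin (suc c) → Fin (suc c)
_⊕_ {c} i j = fromℕ< (s≤s (m⊓n≤m c (toℕ i + toℕ j)))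

toℕ-⊕ : (i j : Fin (suc c)) → toℕ (i ⊕ j) ≡ c ⊓ (toℕ i + toℕ j)
toℕ-⊕ {c} i j = toℕ-fromℕ< (s≤s (m⊓n≤m c (toℕ i + toℕ j)))

i⊕j≤i+j : (i j : Fin (suc c)) → toℕ (i ⊕ j) ≤ toℕ i + toℕ j
i⊕j≤i+j {c} i j = ≤-trans (≤-reflexive (toℕ-⊕ i j)) (m⊓n≤n c (toℕ i + toℕ j))

j≤i⊕j : (i j : Fin (suc c)) → j Fin.≤ i ⊕ j
j≤i⊕j {c} i j = begin
  toℕ j                ≤⟨ ⊓-glb (toℕ≤pred[n] j) (m≤n+m (toℕ j) (toℕ i)) ⟩
  c ⊓ (toℕ i + toℕ j)  ≡⟨ toℕ-⊕ i j ⟨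
  toℕ (i ⊕ j)          ∎
  where open ≤-Reasoning

sumOver-map : (g : Labelling n) (φ : Fin m → Fin n) (vs : List (Fin m)) →
              sumOver g (map φ vs) ≡ sumOver (g ∘ φ) vs
sumOver-map g φ vs = cong sum (sym (map-∘ vs))

weight-suc : (g : Labelling (suc n)) → weight g ≡ toℕ (g zero) + weight (g ∘ suc)
weight-suc {n} g = cong (toℕ (g zero) +_) (begin
  sumOver g (tabulate suc)        ≡⟨ cong (sumOver g) (map-tabulate id suc) ⟨
  sumOver g (map suc (allFin n))  ≡⟨ sumOver-map g suc (allFin n) ⟩
  weight (g ∘ suc)                ∎)
  where open ≡-Reasoning

weight-updateAt : (f : Labelling n) (v : Fin n) (φ : Fin 3 → Fin 3) →
                  toℕ (f v) + weight (updateAt f v φ) ≡ toℕ (φ (f v)) + weight f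
weight-updateAt f zero φ = begin
  old + weight (updateAt f zero φ)  ≡⟨ cong (old +_) (weight-suc (updateAt f zero φ)) ⟩
  old + (new + weight (f ∘ suc))    ≡⟨ x∙yz≈y∙xz old new _ ⟩
  new + (old + weight (f ∘ suc))    ≡⟨ cong (new +_) (weight-suc f) ⟨
  new + weight f                    ∎
  where
  open ≡-Reasoning
  old new : ℕ
  old = toℕ (f zero)
  new = toℕ (φ (f zero))
weight-updateAt f (suc v) φ = begin
  old + weight (updateAt f (suc v) φ)           ≡⟨ cong (old +_) (weight-suc (updateAt f (suc v) φ)) ⟩
  old + (f₀ + weight (updateAt (f ∘ suc) v φ))  ≡⟨ x∙yz≈y∙xz old f₀ _ ⟩
  f₀ + (old + weight (updateAt (f ∘ suc) v φ))  ≡⟨ cong (f₀ +_) (weight-updateAt (f ∘ suc) v φ) ⟩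
  f₀ + (new + weight (f ∘ suc))                 ≡⟨ x∙yz≈y∙xz f₀ new _ ⟩
  new + (f₀ + weight (f ∘ suc))                 ≡⟨ cong (new +_) (weight-suc f) ⟨
  new + weight f                                ∎
  where
  open ≡-Reasoning
  f₀ old new : ℕ
  f₀  = toℕ (f zero)
  old = toℕ (f (suc v))
  new = toℕ (φ (f (suc v)))

Adj⇒∈N : (G : Graph n) {v w : Fin n} → Graph.Adj G v w → w ∈ N G v
Adj⇒∈N G {v} {w} = ∈-filter⁺ (Graph.adj? G v) (∈-allFin w)

module _ (G : Graph n) (u : Fin n) where
  open Graph G using (Adj; adj?)

  private
    H : Graph (suc n)
    H = attachFalseTwin G u

    module H = Graph H

  N-twin-adj : ∀ {v} → Adj v u → N H (suc v) ≡ zero ∷ map suc (N G v)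
  N-twin-adj {v} v~u = trans (filter-accept (H.adj? (suc v)) {zero} {tabulate suc} v~u)
                             (cong (zero ∷_) (filter-tabulate (H.adj? (suc v)) suc))

  N-twin-nonadj : ∀ {v} → ¬ Adj v u → N H (suc v) ≡ map suc (N G v)
  N-twin-nonadj {v} v≁u = trans (filter-reject (H.adj? (suc v)) {zero} {tabulate suc} v≁u)
                                (filter-tabulate (H.adj? (suc v)) suc)

  sumOver-N-twin-adj : ∀ g {v} → Adj v u →
                       sumOver g (N H (suc v)) ≡ toℕ (g zero) + sumOver (g ∘ suc) (N G v)
  sumOver-N-twin-adj g {v} v~u = begin
    sumOver g (N H (suc v))                     ≡⟨ cong (sumOver g) (N-twin-adj v~u) ⟩
    toℕ (g zero) + sumOver g (map suc (N G v))  ≡⟨ cong (toℕ (g zero) +_) (sumOver-map g suc (N G v)) ⟩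
    toℕ (g zero) + sumOver (g ∘ suc) (N G v)    ∎
    where open ≡-Reasoning

  sumOver-N-twin-nonadj : ∀ g {v} → ¬ Adj v u →
                          sumOver g (N H (suc v)) ≡ sumOver (g ∘ suc) (N G v)
  sumOver-N-twin-nonadj g {v} v≁u = trans (cong (sumOver g) (N-twin-nonadj v≁u))
                                          (sumOver-map g suc (N G v))

  sumOver-N≤sumOver-N-twin : ∀ g v → sumOver (g ∘ suc) (N G v) ≤ sumOver g (N H (suc v))
  sumOver-N≤sumOver-N-twin g v = case adj? v u of λ where
    (yes v~u) → ≤-trans (m≤n+m _ (toℕ (g zero))) (≤-reflexive (sym (sumOver-N-twin-adj g v~u)))
    (no  v≁u) → ≤-reflexive (sym (sumOver-N-twin-nonadj g v≁u))

  ∷-IsIDF : ∀ {k f} → k ≢ 0F → IsIDF G f → IsIDF H (k ∷ᵛ f)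
  ∷-IsIDF         k≢0 idf zero    k≡0  =
    contradiction k≡0 k≢0
  ∷-IsIDF {k} {f} k≢0 idf (suc v) fv≡0 =
    ≤-trans (idf v fv≡0) (sumOver-N≤sumOver-N-twin (k ∷ᵛ f) v)

  merge : Labelling (suc n) → Labelling n
  merge g = updateAt (g ∘ suc) u (g zero ⊕_)

  g≤merge : ∀ g v → g (suc v) Fin.≤ merge g v
  g≤merge g = Pointwise-updateAt {R = Fin._≤_} Fin.≤-refl u (g ∘ suc) (j≤i⊕j (g zero) (g (suc u)))

  merge≡0⇒≡0 : ∀ g v → merge g v ≡ 0F → g (suc v) ≡ 0F
  merge≡0⇒≡0 g v mv≡0 =
    toℕ-injective (n≤0⇒n≡0 (subst (g (suc v) Fin.≤_) mv≡0 (g≤merge g v)))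

  toℕ-merge-u : ∀ g → toℕ (merge g u) ≡ 2 ⊓ (toℕ (g zero) + toℕ (g (suc u)))
  toℕ-merge-u g = trans (cong toℕ (updateAt-updates u (g ∘ suc))) (toℕ-⊕ (g zero) (g (suc u)))

  2⊓sumOver-N-twin≤merge : ∀ g v → 2 ⊓ sumOver g (N H (suc v)) ≤ sumOver (merge g) (N G v)
  2⊓sumOver-N-twin≤merge g v = case adj? v u of λ where
      (yes v~u) → begin
        2 ⊓ sumOver g (N H (suc v))           ≡⟨ cong (2 ⊓_) (sumOver-N-twin-adj g v~u) ⟩
        2 ⊓ (g₀ + sumOver (g ∘ suc) (N G v))  ≤⟨ ⊓-sum-map-absorb-≤ (g≤merge g) g₀ u-absorbs
                                                   (Adj⇒∈N G v~u) ⟩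
        sumOver (merge g) (N G v)             ∎
      (no v≁u) → begin
        2 ⊓ sumOver g (N H (suc v))           ≤⟨ m⊓n≤n 2 _ ⟩
        sumOver g (N H (suc v))               ≡⟨ sumOver-N-twin-nonadj g v≁u ⟩
        sumOver (g ∘ suc) (N G v)             ≤⟨ sum-map-mono-≤ (g≤merge g) (N G v) ⟩
        sumOver (merge g) (N G v)             ∎
    where
    open ≤-Reasoning
    g₀ : ℕ
    g₀ = toℕ (g zero)
    u-absorbs : 2 ⊓ (g₀ + toℕ (g (suc u))) ≤ toℕ (merge g u)
    u-absorbs = ≤-reflexive (sym (toℕ-merge-u g))

  merge-IsIDF : ∀ {g} → IsIDF H g → IsIDF G (merge g)
  merge-IsIDF {g} idf v mv≡0 =
    ≤-trans (⊓-glb ≤-refl (idf (suc v) (merge≡0⇒≡0 g v mv≡0))) (2⊓sumOver-N-twin≤merge g v)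

  weight-merge≤ : ∀ g → weight (merge g) ≤ weight g
  weight-merge≤ g = +-cancelˡ-≤ gᵤ _ _ (begin
    gᵤ + weight (merge g)                        ≡⟨ weight-updateAt (g ∘ suc) u (g zero ⊕_) ⟩
    toℕ (g zero ⊕ g (suc u)) + weight (g ∘ suc)  ≤⟨ +-monoˡ-≤ _ (i⊕j≤i+j (g zero) (g (suc u))) ⟩
    g₀ + gᵤ + weight (g ∘ suc)                   ≡⟨ xy∙z≈y∙xz g₀ gᵤ _ ⟩
    gᵤ + (g₀ + weight (g ∘ suc))                 ≡⟨ cong (gᵤ +_) (weight-suc g) ⟨
    gᵤ + weight g                                ∎)
    where
    open ≤-Reasoning
    g₀ gᵤ : ℕ
    g₀ = toℕ (g zero)
    gᵤ = toℕ (g (suc u))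

  γI≤γI-twin : γI G ≤ γI H
  γI≤γI-twin with g , idf , wg≡γ ← γI-attained H = begin
    γI G              ≤⟨ γI-minimal G (merge g) (merge-IsIDF idf) ⟩
    weight (merge g)  ≤⟨ weight-merge≤ g ⟩
    weight g          ≡⟨ wg≡γ ⟩
    γI H              ∎
    where open ≤-Reasoning

  γI-twin≤1+γI : γI H ≤ suc (γI G)
  γI-twin≤1+γI with f , idf , wf≡γ ← γI-attained G = begin
    γI H              ≤⟨ γI-minimal H (1F ∷ᵛ f) (∷-IsIDF (λ ()) idf) ⟩
    weight (1F ∷ᵛ f)  ≡⟨ weight-suc (1F ∷ᵛ f) ⟩
    suc (weight f)    ≡⟨ cong suc wf≡γ ⟩
    suc (γI G)        ∎
    where open ≤-Reasoning

theorem3p4 : ∀ (n : ℕ) (G : Graph n) (u : Fin n) → (γI (attachFalseTwin G u) ≡ γI G) ⊎ (γI (attachFalseTwin G u) ≡ γI G + 1)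
theorem3p4 n G u with m≤n⇒m<n∨m≡n (γI≤γI-twin G u)
... | inj₁ γG<γH = inj₂ (trans (≤-antisym (γI-twin≤1+γI G u) γG<γH) (+-comm 1 (γI G)))
... | inj₂ γG≡γH = inj₁ (sym γG≡γH)
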